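{- For every positive integer $n$, let $\mathrm{PF}_n(321)$ denote the set of parking functions $p=(p_1,\dots,p_n)$ of length $n$ that avoid $321$ as a word, i.e. for which there are no indices $i_1<i_2<i_3$ with $p_{i_1}>p_{i_2}>p_{i_3}$. Let $w_{n,n+1}(321)$ denote the number of words $w_1w_2\cdots w_n$ with all $w_i\in[n+1]$ for which there are no indices $i_1<i_2<i_3$ with $w_{i_1}>w_{i_2}>w_{i_3}$. Then \[|\mathrm{PF}_n(321)| = \frac{1}{n+1}\, w_{n,n+1}(321).\]
   Context: $[n]=\{1,2,\dots,n\}$. A tuple $p=(p_1,\dots,p_n)\in[n]^n$ is a parking function of length $n$ if its weakly increasing rearrangement $(p'_1,\dots,p'_n)$ satisfies $p'_i\le i$ for all $i\in[n]$. -}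

module Defs where

open import Data.Fin using (Fin; toℕ; _<_; _>_)
open import Data.Fin.Properties
  using (≤-decTotalOrder; all?; any?; _<?_)
open import Data.List using (List; [_]; allFin; filter; length; lookup; cartesianProductWith)
open import Data.List.Membership.Propositional using (_∈_)
open import Data.List.Membership.Propositional.Properties
  using (∈-allFin; ∈-cartesianProductWith⁺)
open import Data.List.Relation.Unary.All using ([])
open import Data.List.Relation.Unary.Any using (here)
open import Data.List.Relation.Unary.AllPairs using ([]; _∷_)
open import Data.List.Relation.Unary.Unique.Propositional using (Unique)
open import Data.List.Relation.Unary.Unique.Propositional.Properties
  using (allFin⁺; cartesianProductWith⁺)
import Data.List.Sort
open import Data.Nat using (ℕ; zero; suc; _≤_; _≤?_)
open import Data.Product using (_×_; ∃-syntax)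
open import Data.Vec as Vec using (Vec; []; _∷_; toList)
open import Data.Vec.Properties using (∷-injective)
open import Relation.Binary.PropositionalEquality using (refl)
open import Relation.Nullary using (¬_)
open import Relation.Nullary.Decidable using (_×-dec_; ¬?)
open import Relation.Unary using (Decidable)

-- [m] = {1, …, m} is represented by Fin m: the element i stands for the
-- number label i.  Both letters and positions are read through label.
label : ∀ {m} → Fin m → ℕ
label i = suc (toℕ i)

-- Word m n is [m]ⁿ: words of length n over the alphabet [m].
Word : ℕ → ℕ → Set
Word m n = Vec (Fin m) n

rearrangement : ∀ {m n} → Word m n → List (Fin m)
rearrangement {m} w = sort (toList w)
  where open Data.List.Sort (≤-decTotalOrder m)

ParkingFunction : ∀ {n} → Word n n → Set
ParkingFunction p =
  let p′ = rearrangement p in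
  ∀ (i : Fin (length p′)) → label (lookup p′ i) ≤ label i

Contains321 : ∀ {m n} → Word m n → Set
Contains321 w =
  ∃[ i₁ ] ∃[ i₂ ] ∃[ i₃ ]
    (i₁ < i₂ × i₂ < i₃ ×
     Vec.lookup w i₁ > Vec.lookup w i₂ × Vec.lookup w i₂ > Vec.lookup w i₃)

Avoids321 : ∀ {m n} → Word m n → Set
Avoids321 w = ¬ Contains321 w

parkingFunction? : ∀ {n} → Decidable (ParkingFunction {n})
parkingFunction? p =
  let p′ = rearrangement p in
  all? (λ i → label (lookup p′ i) ≤? label i)

avoids321? : ∀ {m n} → Decidable (Avoids321 {m} {n})
avoids321? w = ¬? (any? λ i₁ → any? λ i₂ → any? λ i₃ →
  i₁ <? i₂ ×-dec i₂ <? i₃ ×-dec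
  Vec.lookup w i₂ <? Vec.lookup w i₁ ×-dec Vec.lookup w i₃ <? Vec.lookup w i₂)

words : ∀ m n → List (Word m n)
words m zero    = [ [] ]
words m (suc n) = cartesianProductWith _∷_ (allFin m) (words m n)

-- Every word occurs in words m n exactly once, so lengths of filtered
-- sublists of words m n are cardinalities.
words-complete : ∀ {m n} (w : Word m n) → w ∈ words m n
words-complete []      = here refl
words-complete (a ∷ w) =
  ∈-cartesianProductWith⁺ _∷_ (∈-allFin a) (words-complete w)

words-unique : ∀ m n → Unique (words m n)
words-unique m zero    = [] ∷ []
words-unique m (suc n) =
  cartesianProductWith⁺ _∷_ ∷-injective (allFin⁺ m) (words-unique m n)

PF321 : ∀ n → List (Word n n)
PF321 n = filter (λ p → parkingFunction? p ×-dec avoids321? p) (words n n)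

∣PF321∣ : ℕ → ℕ
∣PF321∣ n = length (PF321 n)

-- w321 n m is the number of 321-avoiding words of length n over [m].
w321 : ℕ → ℕ → ℕ
w321 n m = length (filter avoids321? (words m n))

{-# OPTIONS --safe #-}
-- Group words by content (the multiplicities of the letters).  Deleting the
-- smallest letter from a 321-avoiding word leaves a 321-avoiding word v, and
-- copies of that letter can be put back anywhere up to the end of the longest
-- weakly increasing prefix of v, and nowhere else.  So the number of 321-avoiding
-- words of content (c₁ , … , cₘ) is obtained by composing one operator per letter
-- on functions of the prefix length.  These operators A₀ = 1, A₁, A₂, … satisfy
-- A₍ₖ₊₂₎ + A₁ Aₖ = A₁ A₍ₖ₊₁₎, so all of them are polynomials in A₁ and commute,
-- and the number does not change when the content is rotated.  Being a parking
-- function depends on the content only, and by the cycle lemma exactly one of the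
-- n + 1 rotations of a content of n letters over [n+1] is that of a parking function.
module Submission where

open import Defs
open import Data.Bool using (Bool; true; false; T; _∧_; if_then_else_)
open import Data.Bool.Properties using (T?)
open import Data.Fin as Fin using (Fin; toℕ)
import Data.Fin.Properties as Fin
import Data.Integer as ℤ
import Data.Integer.Properties as ℤ
open import Data.List as List
  using (List; []; _∷_; _++_; _∷ʳ_; length; map; filter; cartesianProductWith; allFin; tabulate)
open import Data.List.Properties using (++-assoc; ++-identityʳ; length-++; length-map; map-++; map-∘)
open import Data.List.Relation.Binary.Permutation.Propositional as ↭ using (_↭_; prep; swap)
open import Data.List.Relation.Binary.Permutation.Propositional.Properties using (map⁺; ↭-length)
open import Data.List.Relation.Unary.All using (All; []; _∷_)
open import Data.List.Relation.Unary.AllPairs using (AllPairs; []; _∷_)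
import Data.List.Relation.Unary.AllPairs.Properties as AllPairs
open import Data.List.Relation.Unary.Any as Any using (Any; here; there)
open import Data.List.Relation.Unary.Linked.Properties using (Linked⇒AllPairs)
import Data.List.Sort
open import Data.Nat
  using (ℕ; zero; suc; NonZero; _+_; _*_; _<_; _≤_; z<s; s<s; s≤s; z≤n; _<ᵇ_)
open import Data.Nat.ListAction using (sum)
open import Data.Nat.ListAction.Properties using (sum-++)
open import Data.Nat.Properties
open import Data.Nat.Tactic.RingSolver using (solve-∀)
open import Data.Product using (_×_; _,_; ∃-syntax)
open import Data.Rational as ℚ using (_/_)
open import Data.Rational.Properties using (toℚᵘ-injective; toℚᵘ-fromℚᵘ; toℚᵘ-homo-*)
open import Data.Rational.Unnormalised using (mkℚᵘ; *≡*)
import Data.Rational.Unnormalised.Properties as ℚᵘ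
open import Data.Sum using (_⊎_; inj₁; inj₂)
open import Data.Unit using (⊤; tt)
open import Data.Vec as Vec using ([]; _∷_; toList)
open import Data.Vec.Properties using (length-toList)
open import Function using (_∘_; id; _⇔_; mk⇔; Equivalence)
open import Relation.Binary.PropositionalEquality
open import Relation.Nullary using (¬_; does; ofʸ; ofⁿ; contradiction)
open import Relation.Nullary.Decidable using (does-⇔; _×-dec_)
open import Relation.Unary using (Decidable)

open import Algebra.Properties.CommutativeSemigroup +-commutativeSemigroup using (interchange)
open ≡-Reasoning

-- Inserting a new smallest letter

-- The binomial coefficient `k + p` over `k`: the number of ways to put `k` equal letters into
-- `p + 1` gaps.
multichoose : ℕ → ℕ → ℕ
multichoose zero    p       = 1
multichoose (suc k) zero    = 1
multichoose (suc k) (suc p) = multichoose k (suc p) + multichoose (suc k) p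

multichoose-0 : ∀ k → multichoose k 0 ≡ 1
multichoose-0 zero    = refl
multichoose-0 (suc k) = refl

-- insert k φ p is the sum of φ (length of the longest weakly increasing prefix)
-- over all ways to insert k copies of a new smallest letter into a word whose
-- longest weakly increasing prefix has length p, none of them behind that prefix.
-- The part afterLetter k φ p of insert (suc k) φ p is due to the insertions with
-- no copy in front: their prefix ends where the first copy stands, after g ≥ 1
-- letters say, and the other k copies fill the p - g + 1 remaining gaps.
afterLetter : ℕ → (ℕ → ℕ) → ℕ → ℕ
afterLetter k φ zero    = 0
afterLetter k φ (suc p) = φ 1 * multichoose k p + afterLetter k (φ ∘ suc) p

insert : ℕ → (ℕ → ℕ) → ℕ → ℕ
insert zero    φ p = φ p
insert (suc k) φ p = insert k (φ ∘ suc) p + afterLetter k φ p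

afterLetter-cong : ∀ k {φ ψ} → (∀ p → φ p ≡ ψ p) → ∀ p → afterLetter k φ p ≡ afterLetter k ψ p
afterLetter-cong k eq zero    = refl
afterLetter-cong k eq (suc p) =
  cong₂ (λ x y → x * multichoose k p + y) (eq 1) (afterLetter-cong k (λ q → eq (suc q)) p)

insert-cong : ∀ k {φ ψ} → (∀ p → φ p ≡ ψ p) → ∀ p → insert k φ p ≡ insert k ψ p
insert-cong zero    eq p = eq p
insert-cong (suc k) eq p =
  cong₂ _+_ (insert-cong k (λ q → eq (suc q)) p) (afterLetter-cong k eq p)

afterLetter-+ : ∀ k φ ψ p →
  afterLetter k (λ q → φ q + ψ q) p ≡ afterLetter k φ p + afterLetter k ψ p
afterLetter-+ k φ ψ zero    = refl
afterLetter-+ k φ ψ (suc p) = begin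
  (φ 1 + ψ 1) * multichoose k p + afterLetter k (λ q → φ (suc q) + ψ (suc q)) p
    ≡⟨ cong₂ _+_ (*-distribʳ-+ (multichoose k p) (φ 1) (ψ 1)) (afterLetter-+ k (φ ∘ suc) (ψ ∘ suc) p) ⟩
  (φ 1 * multichoose k p + ψ 1 * multichoose k p) +
    (afterLetter k (φ ∘ suc) p + afterLetter k (ψ ∘ suc) p)
    ≡⟨ interchange (φ 1 * multichoose k p) _ _ _ ⟩
  _ ∎

insert-+ : ∀ k φ ψ p → insert k (λ q → φ q + ψ q) p ≡ insert k φ p + insert k ψ p
insert-+ zero    φ ψ p = refl
insert-+ (suc k) φ ψ p =
  trans (cong₂ _+_ (insert-+ k (φ ∘ suc) (ψ ∘ suc) p) (afterLetter-+ k φ ψ p))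
        (interchange (insert k (φ ∘ suc) p) _ _ _)

afterLetter-0-suc : ∀ φ p → afterLetter 0 φ (suc p) ≡ φ (suc p) + afterLetter 0 φ p
afterLetter-0-suc φ zero    = solve (φ 1) where
  solve : ∀ a → a * 1 + 0 ≡ a + 0
  solve = solve-∀
afterLetter-0-suc φ (suc p) = begin
  φ 1 * 1 + afterLetter 0 (φ ∘ suc) (suc p)            ≡⟨ cong (φ 1 * 1 +_) (afterLetter-0-suc (φ ∘ suc) p) ⟩
  φ 1 * 1 + (φ (2 + p) + afterLetter 0 (φ ∘ suc) p)    ≡⟨ lem (φ 1 * 1) (φ (2 + p)) _ ⟩
  φ (2 + p) + (φ 1 * 1 + afterLetter 0 (φ ∘ suc) p)    ∎
  where
  lem : ∀ a b c → a + (b + c) ≡ b + (a + c)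
  lem = solve-∀

insert-1-suc : ∀ φ p → insert 1 φ (suc p) ≡ φ (2 + p) + insert 1 φ p
insert-1-suc φ p = cong (φ (2 + p) +_) (afterLetter-0-suc φ p)

-- The case `k = -1` of `afterLetter-suc`: there the coefficients `multichoose` would be 1 at 0 and
-- 0 elsewhere, so that only `φ (2 + p)` is left of the second summand.
afterLetter-1-suc : ∀ φ p →
  afterLetter 1 φ (suc p) + φ (2 + p) ≡ afterLetter 0 φ (2 + p) + afterLetter 1 φ p
afterLetter-1-suc φ zero    = lem (φ 1) (φ 2) where
  lem : ∀ a b → a * 1 + 0 + b ≡ a * 1 + (b * 1 + 0) + 0
  lem = solve-∀
afterLetter-1-suc φ (suc p) = begin
  φ 1 * (1 + multichoose 1 p) + afterLetter 1 φ′ (suc p) + φ′ (2 + p)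
    ≡⟨ +-assoc (φ 1 * (1 + multichoose 1 p)) _ _ ⟩
  φ 1 * (1 + multichoose 1 p) + (afterLetter 1 φ′ (suc p) + φ′ (2 + p))
    ≡⟨ cong (φ 1 * (1 + multichoose 1 p) +_) (afterLetter-1-suc φ′ p) ⟩
  φ 1 * (1 + multichoose 1 p) + (afterLetter 0 φ′ (2 + p) + afterLetter 1 φ′ p)
    ≡⟨ lem (φ 1) (multichoose 1 p) _ _ ⟩
  φ 1 * 1 + afterLetter 0 φ′ (2 + p) + (φ 1 * multichoose 1 p + afterLetter 1 φ′ p) ∎
  where
  φ′ : ℕ → ℕ
  φ′ = φ ∘ suc
  lem : ∀ a b c d → a * (1 + b) + (c + d) ≡ a * 1 + c + (a * b + d)
  lem = solve-∀

-- In the coefficient of each value of `φ` this is the recursion of `multichoose`, applied at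
-- `2 + k` and at `1 + k`.
afterLetter-suc : ∀ k φ p →
  afterLetter (2 + k) φ (suc p) + afterLetter k φ (2 + p) ≡
  afterLetter (1 + k) φ (2 + p) + afterLetter (2 + k) φ p
afterLetter-suc k φ zero
  rewrite multichoose-0 k = lem (φ 1) (φ 2) (multichoose k 1) where
  lem : ∀ a b m → a * 1 + 0 + (a * m + (b * 1 + 0)) ≡ a * (m + 1) + (b * 1 + 0) + 0
  lem = solve-∀
afterLetter-suc k φ (suc p) = begin
  a * (x + y + z) + c₁ + (a * w + c₂)     ≡⟨ lem₁ a x y z w c₁ c₂ ⟩
  a * (w + (x + y) + z) + (c₁ + c₂)       ≡⟨ cong (a * (w + (x + y) + z) +_) (afterLetter-suc k (φ ∘ suc) p) ⟩
  a * (w + (x + y) + z) + (c₃ + c₄)       ≡⟨ lem₂ a x y z w c₃ c₄ ⟩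
  a * (w + (x + y)) + c₃ + (a * z + c₄)   ∎
  where
  a x y z w c₁ c₂ c₃ c₄ : ℕ
  a = φ 1
  x = multichoose k (suc p)
  y = multichoose (suc k) p
  z = multichoose (2 + k) p
  w = multichoose k (2 + p)
  c₁ = afterLetter (2 + k) (φ ∘ suc) (suc p)
  c₂ = afterLetter k (φ ∘ suc) (2 + p)
  c₃ = afterLetter (1 + k) (φ ∘ suc) (2 + p)
  c₄ = afterLetter (2 + k) (φ ∘ suc) p
  lem₁ : ∀ a x y z w c d → a * (x + y + z) + c + (a * w + d) ≡ a * (w + (x + y) + z) + (c + d)
  lem₁ = solve-∀
  lem₂ : ∀ a x y z w c d → a * (w + (x + y) + z) + (c + d) ≡ a * (w + (x + y)) + c + (a * z + d)
  lem₂ = solve-∀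

-- The increment in `p` of `insert-three-term`: by `insert-1-suc`, passing from `p` to `suc p` adds
-- `ψ (2 + p)` to `insert 1 ψ`.
insert-suc : ∀ k φ p →
  insert (2 + k) φ (suc p) + insert k φ (2 + p) ≡ insert (1 + k) φ (2 + p) + insert (2 + k) φ p
insert-suc zero φ p = begin
  φ (3 + p) + afterLetter 0 φ′ (suc p) + afterLetter 1 φ (suc p) + φ (2 + p)
    ≡⟨ +-assoc (φ (3 + p) + afterLetter 0 φ′ (suc p)) _ _ ⟩
  φ (3 + p) + afterLetter 0 φ′ (suc p) + (afterLetter 1 φ (suc p) + φ (2 + p))
    ≡⟨ cong₂ (λ x y → φ (3 + p) + x + y) (afterLetter-0-suc φ′ p) (afterLetter-1-suc φ p) ⟩
  φ (3 + p) + (φ (2 + p) + afterLetter 0 φ′ p) + (afterLetter 0 φ (2 + p) + afterLetter 1 φ p)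
    ≡⟨ lem (φ (3 + p)) (φ (2 + p)) _ _ _ ⟩
  φ (3 + p) + afterLetter 0 φ (2 + p) + (φ (2 + p) + afterLetter 0 φ′ p + afterLetter 1 φ p) ∎
  where
  φ′ : ℕ → ℕ
  φ′ = φ ∘ suc
  lem : ∀ a b c d e → a + (b + c) + (d + e) ≡ a + d + (b + c + e)
  lem = solve-∀
insert-suc (suc k) φ p =
  trans (interchange (insert (2 + k) (φ ∘ suc) (suc p)) _ _ _)
 (trans (cong₂ _+_ (insert-suc k (φ ∘ suc) p) (afterLetter-suc k φ p))
        (interchange (insert (1 + k) (φ ∘ suc) (2 + p)) _ _ _))

insert-at-0 : ∀ k φ → insert (2 + k) φ 0 + insert k φ 1 ≡ insert (1 + k) φ 1
insert-at-0 zero    φ = lem (φ 1) (φ 2) where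
  lem : ∀ a b → b + 0 + 0 + a ≡ b + (a * 1 + 0)
  lem = solve-∀
insert-at-0 (suc k) φ = begin
  insert (2 + k) φ′ 0 + 0 + (insert k φ′ 1 + (φ 1 * multichoose k 0 + 0))
    ≡⟨ interchange (insert (2 + k) φ′ 0) _ _ _ ⟩
  insert (2 + k) φ′ 0 + insert k φ′ 1 + (φ 1 * multichoose k 0 + 0)
    ≡⟨ cong₂ (λ x y → x + (φ 1 * y + 0)) (insert-at-0 k φ′) (multichoose-0 k) ⟩
  insert (1 + k) φ′ 1 + (φ 1 * 1 + 0) ∎
  where
  φ′ : ℕ → ℕ
  φ′ = φ ∘ suc

insert-three-term : ∀ k φ p →
  insert (2 + k) φ p + insert 1 (insert k φ) p ≡ insert 1 (insert (1 + k) φ) p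
insert-three-term k φ zero = begin
  insert (2 + k) φ 0 + (insert k φ 1 + 0)  ≡⟨ cong (insert (2 + k) φ 0 +_) (+-identityʳ _) ⟩
  insert (2 + k) φ 0 + insert k φ 1        ≡⟨ insert-at-0 k φ ⟩
  insert (1 + k) φ 1                       ≡⟨ +-identityʳ _ ⟨
  insert (1 + k) φ 1 + 0                   ∎
insert-three-term k φ (suc p) = begin
  insert (2 + k) φ (suc p) + insert 1 (insert k φ) (suc p)
    ≡⟨ cong (insert (2 + k) φ (suc p) +_) (insert-1-suc (insert k φ) p) ⟩
  insert (2 + k) φ (suc p) + (insert k φ (2 + p) + insert 1 (insert k φ) p)
    ≡⟨ +-assoc (insert (2 + k) φ (suc p)) _ _ ⟨
  insert (2 + k) φ (suc p) + insert k φ (2 + p) + insert 1 (insert k φ) p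
    ≡⟨ cong (_+ insert 1 (insert k φ) p) (insert-suc k φ p) ⟩
  insert (1 + k) φ (2 + p) + insert (2 + k) φ p + insert 1 (insert k φ) p
    ≡⟨ +-assoc (insert (1 + k) φ (2 + p)) _ _ ⟩
  insert (1 + k) φ (2 + p) + (insert (2 + k) φ p + insert 1 (insert k φ) p)
    ≡⟨ cong (insert (1 + k) φ (2 + p) +_) (insert-three-term k φ p) ⟩
  insert (1 + k) φ (2 + p) + insert 1 (insert (1 + k) φ) p
    ≡⟨ insert-1-suc (insert (1 + k) φ) p ⟨
  insert 1 (insert (1 + k) φ) (suc p) ∎

-- Two-step induction on `k`: the three-term relation expresses `insert (2 + k)` through `insert 1`
-- and the two preceding operators.
commutes-with-insert : ∀ j →
  (∀ φ p → insert j (insert 1 φ) p ≡ insert 1 (insert j φ) p) →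
  ∀ k φ p → insert j (insert k φ) p ≡ insert k (insert j φ) p
commutes-with-insert j comm₁ zero          φ p = refl
commutes-with-insert j comm₁ (suc zero)    φ p = comm₁ φ p
commutes-with-insert j comm₁ (suc (suc k)) φ p =
  -- The relation gives `insert (2 + k)` only as a difference, so the subtracted term is added to
  -- both sides and cancelled.
  +-cancelʳ-≡ (insert j (insert 1 (insert k φ)) p) _ _ (begin
    insert j (insert (2 + k) φ) p + insert j (insert 1 (insert k φ)) p
      ≡⟨ insert-+ j (insert (2 + k) φ) (insert 1 (insert k φ)) p ⟨
    insert j (λ q → insert (2 + k) φ q + insert 1 (insert k φ) q) p
      ≡⟨ insert-cong j (insert-three-term k φ) p ⟩
    insert j (insert 1 (insert (1 + k) φ)) p
      ≡⟨ comm₁ (insert (1 + k) φ) p ⟩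
    insert 1 (insert j (insert (1 + k) φ)) p
      ≡⟨ insert-cong 1 (commutes-with-insert j comm₁ (suc k) φ) p ⟩
    insert 1 (insert (1 + k) (insert j φ)) p
      ≡⟨ insert-three-term k (insert j φ) p ⟨
    insert (2 + k) (insert j φ) p + insert 1 (insert k (insert j φ)) p
      ≡⟨ cong (insert (2 + k) (insert j φ) p +_) (insert-cong 1 (commutes-with-insert j comm₁ k φ) p) ⟨
    insert (2 + k) (insert j φ) p + insert 1 (insert j (insert k φ)) p
      ≡⟨ cong (insert (2 + k) (insert j φ) p +_) (comm₁ (insert k φ) p) ⟨
    insert (2 + k) (insert j φ) p + insert j (insert 1 (insert k φ)) p ∎)

-- Two applications: since `insert 1` commutes with itself it commutes with `insert j`, and this is
-- the hypothesis for general `j`.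
insert-comm : ∀ j k φ p → insert j (insert k φ) p ≡ insert k (insert j φ) p
insert-comm j =
  commutes-with-insert j (λ φ p → sym (commutes-with-insert 1 (λ _ _ → refl) j φ p))

-- Sums

𝟙 : Bool → ℕ
𝟙 false = 0
𝟙 true  = 1

𝟙-true : ∀ {b} → T b → 𝟙 b ≡ 1
𝟙-true {true} _ = refl

𝟙-false : ∀ {b} → ¬ T b → 𝟙 b ≡ 0
𝟙-false {true}  ¬p = contradiction tt ¬p
𝟙-false {false} _  = refl

sumBelow : ℕ → (ℕ → ℕ) → ℕ
sumBelow zero    f = 0
sumBelow (suc m) f = f 0 + sumBelow m (f ∘ suc)

sumBelow-cong : ∀ m {f g} → (∀ i → i < m → f i ≡ g i) → sumBelow m f ≡ sumBelow m g
sumBelow-cong zero    eq = refl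
sumBelow-cong (suc m) eq =
  cong₂ _+_ (eq 0 z<s) (sumBelow-cong m (λ i i<m → eq (suc i) (s<s i<m)))

sumBelow-const : ∀ m a → sumBelow m (λ _ → a) ≡ m * a
sumBelow-const zero    a = refl
sumBelow-const (suc m) a = cong (a +_) (sumBelow-const m a)

sumBelow-+ : ∀ m f g → sumBelow m (λ i → f i + g i) ≡ sumBelow m f + sumBelow m g
sumBelow-+ zero    f g = refl
sumBelow-+ (suc m) f g =
  trans (cong (f 0 + g 0 +_) (sumBelow-+ m (f ∘ suc) (g ∘ suc))) (interchange (f 0) _ _ _)

*-distribˡ-sumBelow : ∀ m a f → a * sumBelow m f ≡ sumBelow m (λ i → a * f i)
*-distribˡ-sumBelow zero    a f = *-zeroʳ a
*-distribˡ-sumBelow (suc m) a f =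
  trans (*-distribˡ-+ a (f 0) _) (cong (a * f 0 +_) (*-distribˡ-sumBelow m a (f ∘ suc)))

sumBelow-last : ∀ m f → f 0 + sumBelow m (f ∘ suc) ≡ sumBelow m f + f m
sumBelow-last zero    f = +-comm (f 0) 0
sumBelow-last (suc m) f =
  trans (cong (f 0 +_) (sumBelow-last m (f ∘ suc))) (sym (+-assoc (f 0) _ _))

-- Sum over all pairs (k , l) with k + l = n.
sumSplit : ℕ → (ℕ → ℕ → ℕ) → ℕ
sumSplit zero    f = f 0 0
sumSplit (suc n) f = f 0 (suc n) + sumSplit n (f ∘ suc)

sumSplit-cong : ∀ n {f g} → (∀ k l → k + l ≡ n → f k l ≡ g k l) → sumSplit n f ≡ sumSplit n g
sumSplit-cong zero    eq = eq 0 0 refl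
sumSplit-cong (suc n) eq =
  cong₂ _+_ (eq 0 (suc n) refl) (sumSplit-cong n (λ k l k+l≡n → eq (suc k) l (cong suc k+l≡n)))

sumSplit-+ : ∀ n f g → sumSplit n (λ k l → f k l + g k l) ≡ sumSplit n f + sumSplit n g
sumSplit-+ zero    f g = refl
sumSplit-+ (suc n) f g =
  trans (cong (f 0 (suc n) + g 0 (suc n) +_) (sumSplit-+ n (f ∘ suc) (g ∘ suc)))
        (interchange (f 0 (suc n)) _ _ _)

sumSplit-0 : ∀ n → sumSplit n (λ _ _ → 0) ≡ 0
sumSplit-0 zero    = refl
sumSplit-0 (suc n) = sumSplit-0 n

sumSplit-last : ∀ n f → sumSplit (suc n) f ≡ sumSplit n (λ k l → f k (suc l)) + f (suc n) 0
sumSplit-last zero    f = refl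
sumSplit-last (suc n) f =
  trans (cong (f 0 (2 + n) +_) (sumSplit-last n (f ∘ suc))) (sym (+-assoc (f 0 (2 + n)) _ _))

sumSplit-first : ∀ n {f} → (∀ k l → f (suc k) l ≡ 0) → sumSplit n f ≡ f 0 n
sumSplit-first zero        eq = refl
sumSplit-first (suc n) {f} eq = begin
  f 0 (suc n) + sumSplit n (f ∘ suc)      ≡⟨ cong (f 0 (suc n) +_) (sumSplit-cong n (λ k l _ → eq k l)) ⟩
  f 0 (suc n) + sumSplit n (λ _ _ → 0)    ≡⟨ cong (f 0 (suc n) +_) (sumSplit-0 n) ⟩
  f 0 (suc n) + 0                         ≡⟨ +-identityʳ _ ⟩
  f 0 (suc n)                             ∎

-- Made for shuffles of `k` zeros with `l` letters, sorted by their first entry: `g` collects those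
-- starting with a zero, `h` those starting with a letter. If `k` or `l` is 0, only one kind occurs.
sumSplit-suc : ∀ n {f} g h →
  (∀ l → f 0 (suc l) ≡ h 0 l) → (∀ k → f (suc k) 0 ≡ g k 0) →
  (∀ k l → f (suc k) (suc l) ≡ g k (suc l) + h (suc k) l) →
  sumSplit (suc n) f ≡ sumSplit n g + sumSplit n h
sumSplit-suc zero    g h f₀ f₁ f₂ = trans (cong₂ _+_ (f₀ 0) (f₁ 0)) (+-comm (h 0 0) (g 0 0))
sumSplit-suc (suc n) {f} g h f₀ f₁ f₂ = begin
  f 0 (2 + n) + sumSplit (suc n) (f ∘ suc)
    ≡⟨ cong (f 0 (2 + n) +_) (sumSplit-last n (f ∘ suc)) ⟩
  f 0 (2 + n) + (sumSplit n (λ k l → f (suc k) (suc l)) + f (2 + n) 0)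
    ≡⟨ cong₂ _+_ (f₀ (suc n)) (cong₂ _+_ (sumSplit-cong n (λ k l _ → f₂ k l)) (f₁ (suc n))) ⟩
  h 0 (suc n) + (sumSplit n (λ k l → g k (suc l) + h (suc k) l) + g (suc n) 0)
    ≡⟨ cong (λ a → h 0 (suc n) + (a + g (suc n) 0)) (sumSplit-+ n (λ k l → g k (suc l)) (h ∘ suc)) ⟩
  h 0 (suc n) + (sumSplit n (λ k l → g k (suc l)) + sumSplit n (h ∘ suc) + g (suc n) 0)
    ≡⟨ lem (h 0 (suc n)) (sumSplit n (λ k l → g k (suc l))) _ _ ⟩
  sumSplit n (λ k l → g k (suc l)) + g (suc n) 0 + (h 0 (suc n) + sumSplit n (h ∘ suc))
    ≡⟨ cong (_+ sumSplit (suc n) h) (sumSplit-last n g) ⟨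
  sumSplit (suc n) g + sumSplit (suc n) h ∎
  where
  lem : ∀ a b c d → a + (b + c + d) ≡ b + d + (a + c)
  lem = solve-∀

sumSplit-sumBelow : ∀ n m (f : ℕ → ℕ → ℕ → ℕ) →
  sumSplit n (λ k l → sumBelow m (f k l)) ≡ sumBelow m (λ i → sumSplit n (λ k l → f k l i))
sumSplit-sumBelow n zero    f = sumSplit-0 n
sumSplit-sumBelow n (suc m) f =
  trans (sumSplit-+ n (λ k l → f k l 0) _)
        (cong (sumSplit n (λ k l → f k l 0) +_) (sumSplit-sumBelow n m (λ k l → f k l ∘ suc)))

sumSplit₃ : ℕ → (ℕ → ℕ → ℕ → ℕ) → ℕ
sumSplit₃ n f = sumSplit n (λ j l → sumSplit l (f j))

sumSplit₃-suc : ∀ n f →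
  sumSplit₃ (suc n) f ≡ sumSplit (suc n) (λ j l → f j 0 l) + sumSplit₃ n (λ j → f j ∘ suc)
sumSplit₃-suc zero    f = lem (f 0 0 1) (f 0 1 0) (f 1 0 0) where
  lem : ∀ a b c → a + b + c ≡ a + c + b
  lem = solve-∀
sumSplit₃-suc (suc n) f =
  trans (cong (sumSplit (2 + n) (f 0) +_) (sumSplit₃-suc n (f ∘ suc)))
        (interchange (f 0 0 (2 + n)) (sumSplit (suc n) (f 0 ∘ suc)) (sumSplit (suc n) (λ j l → f (suc j) 0 l)) _)

-- `sumSplit₃-suc` splits off the terms with middle index 0 on the left; on the right the definition
-- splits off those with first index 0.
sumSplit₃-swap : ∀ n f → sumSplit₃ n f ≡ sumSplit₃ n (λ j k → f k j)
sumSplit₃-swap zero    f = refl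
sumSplit₃-swap (suc n) f =
  trans (sumSplit₃-suc n f)
        (cong (sumSplit (suc n) (λ j l → f j 0 l) +_) (sumSplit₃-swap n (λ j → f j ∘ suc)))

-- Sum over all contents: the lists of length m with sum n.
sumContents : ℕ → ℕ → (List ℕ → ℕ) → ℕ
sumContents zero    zero    h = h []
sumContents zero    (suc n) h = 0
sumContents (suc m) n       h = sumSplit n (λ k l → sumContents m l (h ∘ (k ∷_)))

sumContents-cong : ∀ m n {h h′} → (∀ c → length c ≡ m → sum c ≡ n → h c ≡ h′ c) →
  sumContents m n h ≡ sumContents m n h′
sumContents-cong zero    zero    eq = eq [] refl refl
sumContents-cong zero    (suc n) eq = refl
sumContents-cong (suc m) n       eq = sumSplit-cong n λ k l k+l≡n → sumContents-cong m l λ c len tot →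
  eq (k ∷ c) (cong suc len) (trans (cong (k +_) tot) k+l≡n)

sumContents-0 : ∀ m n → sumContents m n (λ _ → 0) ≡ 0
sumContents-0 zero    zero    = refl
sumContents-0 zero    (suc n) = refl
sumContents-0 (suc m) n       = trans (sumSplit-cong n (λ k l _ → sumContents-0 m l)) (sumSplit-0 n)

sumContents-sumBelow : ∀ m n r (h : List ℕ → ℕ → ℕ) →
  sumContents m n (λ c → sumBelow r (h c)) ≡ sumBelow r (λ i → sumContents m n (λ c → h c i))
sumContents-sumBelow zero    zero    r h = refl
sumContents-sumBelow zero    (suc n) r h = sym (trans (sumBelow-const r 0) (*-zeroʳ r))
sumContents-sumBelow (suc m) n       r h =
  trans (sumSplit-cong n (λ k l _ → sumContents-sumBelow m l r (h ∘ (k ∷_))))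
        (sumSplit-sumBelow n r _)

-- Induction splits off both the first entry `j` and the last entry `k`; `sumSplit₃-swap` then
-- exchanges the two outer sums.
sumContents-∷ʳ : ∀ m n h →
  sumContents (suc m) n h ≡ sumSplit n (λ k l → sumContents m l (λ c → h (c ∷ʳ k)))
sumContents-∷ʳ zero    n h = sumSplit-cong n λ { k l _ → sumContents-cong zero l λ { [] _ _ → refl } }
sumContents-∷ʳ (suc m) n h =
  trans (sumSplit-cong n (λ k l _ → sumContents-∷ʳ m l (h ∘ (k ∷_))))
        (sumSplit₃-swap n (λ j k l → sumContents m l (λ c → h (j ∷ c ∷ʳ k))))

-- Rotations of contents

rotate : List ℕ → List ℕ
rotate []      = []
rotate (k ∷ c) = c ∷ʳ k

sumContents-rotate : ∀ m n h → sumContents m n (h ∘ rotate) ≡ sumContents m n h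
sumContents-rotate zero    zero    h = refl
sumContents-rotate zero    (suc n) h = refl
sumContents-rotate (suc m) n       h = sym (sumContents-∷ʳ m n h)

rotateBy : ℕ → List ℕ → List ℕ
rotateBy zero    c = c
rotateBy (suc i) c = rotateBy i (rotate c)

rotateBy-++ : ∀ x y → rotateBy (length x) (x ++ y) ≡ y ++ x
rotateBy-++ []      y = sym (++-identityʳ y)
rotateBy-++ (k ∷ x) y = begin
  rotateBy (length x) ((x ++ y) ∷ʳ k)  ≡⟨ cong (rotateBy (length x)) (++-assoc x y (k ∷ [])) ⟩
  rotateBy (length x) (x ++ (y ∷ʳ k))  ≡⟨ rotateBy-++ x (y ∷ʳ k) ⟩
  (y ∷ʳ k) ++ x                        ≡⟨ ++-assoc y (k ∷ []) x ⟩
  y ++ k ∷ x                           ∎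

-- Falling walks and the cycle lemma

-- The walk with steps k - 1 for the entries k of a list, started at height h,
-- falls below 0 at the end of the list and not earlier.
mutual
  falls : ℕ → List ℕ → Bool
  falls h []      = false
  falls h (k ∷ c) = fallsAfter (h + k) c

  fallsAfter : ℕ → List ℕ → Bool
  fallsAfter zero    []      = true
  fallsAfter zero    (_ ∷ _) = false
  fallsAfter (suc h) c       = falls h c

falls-sum : ∀ h c → T (falls h c) → suc (h + sum c) ≡ length c
falls-sum h (k ∷ c) p = trans (cong suc (sym (+-assoc h k (sum c)))) (cong suc (after (h + k) c p))
  where
  after : ∀ h c → T (fallsAfter h c) → h + sum c ≡ length c
  after zero    []      p = refl
  after (suc h) c       p = falls-sum h c p

data Stays : ℕ → List ℕ → ℕ → Set where
  []  : ∀ {h} → Stays h [] h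
  _∷_ : ∀ {h k c h₁ h₂} → h + k ≡ suc h₁ → Stays h₁ c h₂ → Stays h (k ∷ c) h₂

Stays-sum : ∀ {h c h′} → Stays h c h′ → h + sum c ≡ length c + h′
Stays-sum {h} [] = +-identityʳ h
Stays-sum {h} {k ∷ c} (eq ∷ s) =
  trans (sym (+-assoc h k (sum c))) (trans (cong (_+ sum c) eq) (cong suc (Stays-sum s)))

falls-++⁻ : ∀ h x k y → T (falls h (x ++ k ∷ y)) → ∃[ h′ ] Stays h x h′ × T (falls h′ (k ∷ y))
falls-++⁻ h []      k y p = h , [] , p
falls-++⁻ h (j ∷ x) k y p = after (h + j) refl x p
  where
  after : ∀ h₁ → h + j ≡ h₁ → ∀ x → T (fallsAfter h₁ (x ++ k ∷ y)) →
          ∃[ h′ ] Stays h (j ∷ x) h′ × T (falls h′ (k ∷ y))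
  after zero     eq []      ()
  after zero     eq (_ ∷ _) ()
  after (suc h₁) eq x       p with falls-++⁻ h₁ x k y p
  ... | h′ , s , q = h′ , (eq ∷ s) , q

falls-++⁺ : ∀ {h x h′} y → Stays h x h′ → T (falls h′ y) → T (falls h (x ++ y))
falls-++⁺ y []       p = p
falls-++⁺ y (eq ∷ s) p rewrite eq = falls-++⁺ y s p

-- As the final block of a falling walk, `k ∷ y` leads from some `h ≥ 0` to -1, a net loss; as a
-- proper initial block it leads from 0 to some `h′ ≥ 0`.
falls-rotate-unique : ∀ j x k y → T (falls 0 (j ∷ x ++ k ∷ y)) → ¬ T (falls 0 ((k ∷ y) ++ j ∷ x))
falls-rotate-unique j x k y p q
  with h , s , r ← falls-++⁻ 0 (j ∷ x) k y p
     | h′ , s′ , _ ← falls-++⁻ 0 (k ∷ y) j x q =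
  <-irrefl refl (≤-trans (s≤s len≤) (≤-reflexive (falls-sum h (k ∷ y) r)))
  where
  len≤ : length (k ∷ y) ≤ h + sum (k ∷ y)
  len≤ = ≤-trans (m≤m+n _ h′) (≤-trans (≤-reflexive (sym (Stays-sum s′))) (m≤n+m _ h))

falls-suc-++ : ∀ h x {y} → T (falls h x) → T (falls 0 y) → T (falls (suc h) (x ++ y))
falls-suc-++ h (k ∷ x) {y} p q = after (h + k) x p
  where
  after : ∀ h₁ x → T (fallsAfter h₁ x) → T (fallsAfter (suc h₁) (x ++ y))
  after zero     [] p = q
  after (suc h₁) x  p = falls-suc-++ h₁ x p q

-- The walk from height `t` first reaches 0 at the end of `x`. This is `falls` one level up, which
-- admits the empty `x` at `t = 0`.
Lands : ℕ → List ℕ → Set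
Lands zero    x = x ≡ []
Lands (suc t) x = T (falls t x)

Lands-sum : ∀ t x → Lands t x → t + sum x ≡ length x
Lands-sum zero    .[] refl = refl
Lands-sum (suc t) x   p    = falls-sum t x p

Lands-++ : ∀ t x {y} → Lands t x → T (falls 0 y) → T (falls t (x ++ y))
Lands-++ zero    .[] refl q = q
Lands-++ (suc t) x   p    q = falls-suc-++ t x p q

-- Cut c after the last record low of its walk: the part r after the cut stays
-- above the cut, and the part x before it lands t levels below its start.
falls-rotation : ∀ {c} → suc (sum c) ≡ length c →
  ∃[ x ] ∃[ y ] c ≡ x ++ y × T (falls 0 (y ++ x))
falls-rotation {c} tot = search 0 0 [] [] c refl refl []
  where
  search : ∀ t h x r rest → c ≡ x ++ r ++ rest → Lands t x → Stays 0 r h →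
    ∃[ x ] ∃[ y ] c ≡ x ++ y × T (falls 0 (y ++ x))
  -- The whole walk ends at `h - t`, and at -1 by the hypothesis on the sum. So `t` is `suc h`, and
  -- `x` falls from the height `h` at which `r` ends.
  search t h x r [] eq p s = x , r , eq′ , falls-++⁺ x s (subst (λ t → Lands t x) t≡1+h p)
    where
    eq′ : c ≡ x ++ r
    eq′ = trans eq (cong (x ++_) (++-identityʳ r))
    sums : sum x + length r + suc h ≡ sum x + length r + t
    sums = begin
      sum x + length r + suc h       ≡⟨ lem₁ (sum x) (length r) h ⟩
      suc (sum x + (length r + h))   ≡⟨ cong (λ a → suc (sum x + a)) (Stays-sum s) ⟨
      suc (sum x + sum r)            ≡⟨ cong suc (sum-++ x r) ⟨
      suc (sum (x ++ r))             ≡⟨ cong (suc ∘ sum) eq′ ⟨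
      suc (sum c)                    ≡⟨ tot ⟩
      length c                       ≡⟨ cong length eq′ ⟩
      length (x ++ r)                ≡⟨ length-++ x ⟩
      length x + length r            ≡⟨ cong (_+ length r) (Lands-sum t x p) ⟨
      t + sum x + length r           ≡⟨ lem₂ t (sum x) (length r) ⟩
      sum x + length r + t           ∎
      where
      lem₁ : ∀ a b c → a + b + suc c ≡ suc (a + (b + c))
      lem₁ = solve-∀
      lem₂ : ∀ a b c → a + b + c ≡ b + c + a
      lem₂ = solve-∀
    t≡1+h : t ≡ suc h
    t≡1+h = sym (+-cancelˡ-≡ (sum x + length r) _ _ sums)
  search t h x r (k ∷ rest) eq p s with h + k in eq₁
  ... | suc h′ = search t h′ x (r ∷ʳ k) rest
                   (trans eq (cong (x ++_) (sym (++-assoc r (k ∷ []) rest)))) p (Stays-∷ʳ s eq₁)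
    where
    Stays-∷ʳ : ∀ {h₀ r h₁} → Stays h₀ r h₁ → h₁ + k ≡ suc h′ → Stays h₀ (r ∷ʳ k) h′
    Stays-∷ʳ []       eq = eq ∷ []
    Stays-∷ʳ (e ∷ s) eq = e ∷ Stays-∷ʳ s eq
  -- A new record low: `r ∷ʳ k` falls from 0, so it joins `x`, which now lands one level deeper.
  ... | zero = search (suc t) 0 (x ++ r ∷ʳ k) [] rest
                 (trans eq (trans (cong (x ++_) (sym (++-assoc r (k ∷ []) rest)))
                                  (sym (++-assoc x (r ∷ʳ k) rest))))
                 (Lands-++ t x p (falls-++⁺ (k ∷ []) s (subst (λ a → T (fallsAfter a [])) (sym eq₁) tt)))
                 []

fallingRotations : List ℕ → ℕ
fallingRotations c = sumBelow (length c) (λ i → 𝟙 (falls 0 (rotateBy i c)))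

-- The summation index shifts by one, and the term that enters equals the one that leaves because a
-- full turn is the identity.
fallingRotations-rotate : ∀ c → fallingRotations (rotate c) ≡ fallingRotations c
fallingRotations-rotate []        = refl
fallingRotations-rotate c@(k ∷ c′) =
  trans (cong (λ m → sumBelow m (f ∘ suc)) (trans (length-++ c′) (+-comm (length c′) 1)))
        (+-cancelˡ-≡ (f 0) _ _ (begin
          f 0 + sumBelow (length c) (f ∘ suc)     ≡⟨ sumBelow-last (length c) f ⟩
          sumBelow (length c) f + f (length c)    ≡⟨ cong (λ d → sumBelow (length c) f + 𝟙 (falls 0 d)) full-turn ⟩
          sumBelow (length c) f + f 0             ≡⟨ +-comm _ (f 0) ⟩
          f 0 + sumBelow (length c) f             ∎))
  where
  f : ℕ → ℕ
  f i = 𝟙 (falls 0 (rotateBy i c))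
  full-turn : rotateBy (length c) c ≡ c
  full-turn = trans (cong (rotateBy (length c)) (sym (++-identityʳ c))) (rotateBy-++ c [])

fallingRotations-rotateBy : ∀ i c → fallingRotations (rotateBy i c) ≡ fallingRotations c
fallingRotations-rotateBy zero    c = refl
fallingRotations-rotateBy (suc i) c =
  trans (fallingRotations-rotateBy i (rotate c)) (fallingRotations-rotate c)

fallingRotations-falls : ∀ c → T (falls 0 c) → fallingRotations c ≡ 1
fallingRotations-falls c@(j ∷ c′) p = cong₂ _+_ (𝟙-true p)
  (trans (sumBelow-cong (length c′) proper) (trans (sumBelow-const (length c′) 0) (*-zeroʳ (length c′))))
  where
  split : ∀ i (d : List ℕ) → i < length d → ∃[ x ] ∃[ k ] ∃[ y ] length x ≡ i × x ++ k ∷ y ≡ d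
  split zero    (k ∷ d) _         = [] , k , d , refl , refl
  split (suc i) (a ∷ d) (s<s i<m) with x , k , y , len , eq ← split i d i<m =
    a ∷ x , k , y , cong suc len , cong (a ∷_) eq
  proper : ∀ i → i < length c′ → 𝟙 (falls 0 (rotateBy (suc i) c)) ≡ 0
  proper i i<m with split i c′ i<m
  ... | x , k , y , refl , refl = 𝟙-false λ q →
    falls-rotate-unique j x k y p (subst (T ∘ falls 0) (rotateBy-++ (j ∷ x) (k ∷ y)) q)

-- The last step of a falling walk goes down, but an entry `suc k` gives a step of `k ≥ 0`.
falls-∷ʳ-suc : ∀ h c k → ¬ T (falls h (c ∷ʳ suc k))
falls-∷ʳ-suc h c k p with falls-++⁻ h c (suc k) [] p
... | h′ , _ , q rewrite +-suc h′ k = q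

-- The count is invariant under rotation, so it may be taken at the falling rotation from
-- `falls-rotation`, where `falls-rotate-unique` excludes all others.
cycle-lemma : ∀ c → suc (sum c) ≡ length c → fallingRotations c ≡ 1
cycle-lemma c tot with falls-rotation {c} tot
... | x , y , refl , p = begin
  fallingRotations (x ++ y)                        ≡⟨ fallingRotations-rotateBy (length x) (x ++ y) ⟨
  fallingRotations (rotateBy (length x) (x ++ y))  ≡⟨ cong fallingRotations (rotateBy-++ x y) ⟩
  fallingRotations (y ++ x)                        ≡⟨ fallingRotations-falls (y ++ x) p ⟩
  1                                                ∎

-- Sums over contents are invariant under rotation

-- The sum of `φ` (prefix length) over the 321-avoiding words of content `c`, as `sumWords-weight`
-- shows. The head of `c` belongs to the smallest letter, which is inserted last, so its operator
-- meets `φ` first.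
weight : (ℕ → ℕ) → List ℕ → ℕ
weight φ []      = φ 0
weight φ (k ∷ c) = weight (insert k φ) c

weight-cong : ∀ {φ ψ} c → (∀ p → φ p ≡ ψ p) → weight φ c ≡ weight ψ c
weight-cong []      eq = eq 0
weight-cong (k ∷ c) eq = weight-cong c (insert-cong k eq)

weight-∷ʳ : ∀ φ c k → weight φ (c ∷ʳ k) ≡ weight (insert k φ) c
weight-∷ʳ φ []      k = refl
weight-∷ʳ φ (j ∷ c) k = trans (weight-∷ʳ (insert j φ) c k) (weight-cong c (insert-comm k j φ))

weight-rotate : ∀ φ c → weight φ (rotate c) ≡ weight φ c
weight-rotate φ []      = refl
weight-rotate φ (k ∷ c) = weight-∷ʳ φ c k

sumContents-weight-rotateBy : ∀ m n φ (f : List ℕ → ℕ) i →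
  sumContents m n (λ c → weight φ c * f (rotateBy i c)) ≡ sumContents m n (λ c → weight φ c * f c)
sumContents-weight-rotateBy m n φ f zero    = refl
sumContents-weight-rotateBy m n φ f (suc i) = begin
  sumContents m n (λ c → weight φ c * f (rotateBy i (rotate c)))
    ≡⟨ sumContents-cong m n (λ c _ _ → cong (_* f (rotateBy i (rotate c))) (weight-rotate φ c)) ⟨
  sumContents m n (λ c → weight φ (rotate c) * f (rotateBy i (rotate c)))
    ≡⟨ sumContents-rotate m n (λ c → weight φ c * f (rotateBy i c)) ⟩
  sumContents m n (λ c → weight φ c * f (rotateBy i c))
    ≡⟨ sumContents-weight-rotateBy m n φ f i ⟩
  sumContents m n (λ c → weight φ c * f c) ∎

-- The cycle lemma writes 1 as the number of falling rotations of `c`. Since `weight` is invariant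
-- under rotation, each of the `suc n` rotations contributes the same sum.
sumContents-weight : ∀ n φ →
  suc n * sumContents (suc n) n (λ c → weight φ c * 𝟙 (falls 0 c)) ≡ sumContents (suc n) n (weight φ)
sumContents-weight n φ = sym (begin
  sumContents (suc n) n (weight φ)
    ≡⟨ sumContents-cong (suc n) n expand ⟩
  sumContents (suc n) n (λ c → sumBelow (suc n) (λ i → weight φ c * f (rotateBy i c)))
    ≡⟨ sumContents-sumBelow (suc n) n (suc n) (λ c i → weight φ c * f (rotateBy i c)) ⟩
  sumBelow (suc n) (λ i → sumContents (suc n) n (λ c → weight φ c * f (rotateBy i c)))
    ≡⟨ sumBelow-cong (suc n) (λ i _ → sumContents-weight-rotateBy (suc n) n φ f i) ⟩
  sumBelow (suc n) (λ _ → sumContents (suc n) n (λ c → weight φ c * f c))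
    ≡⟨ sumBelow-const (suc n) _ ⟩
  suc n * sumContents (suc n) n (λ c → weight φ c * f c) ∎)
  where
  f : List ℕ → ℕ
  f = 𝟙 ∘ falls 0
  expand : ∀ c → length c ≡ suc n → sum c ≡ n →
    weight φ c ≡ sumBelow (suc n) (λ i → weight φ c * f (rotateBy i c))
  expand c len tot = begin
    weight φ c
      ≡⟨ *-identityʳ (weight φ c) ⟨
    weight φ c * 1
      ≡⟨ cong (weight φ c *_) (cycle-lemma c (trans (cong suc tot) (sym len))) ⟨
    weight φ c * sumBelow (length c) (λ i → f (rotateBy i c))
      ≡⟨ cong (λ m → weight φ c * sumBelow m (λ i → f (rotateBy i c))) len ⟩
    weight φ c * sumBelow (suc n) (λ i → f (rotateBy i c))
      ≡⟨ *-distribˡ-sumBelow (suc n) (weight φ c) (λ i → f (rotateBy i c)) ⟩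
    sumBelow (suc n) (λ i → weight φ c * f (rotateBy i c)) ∎

-- A falling content ends in 0 by `falls-∷ʳ-suc`, and a letter of multiplicity 0 leaves the weight
-- unchanged because `insert 0 φ` is `φ`.
sumContents-falls : ∀ m n φ →
  sumContents (suc m) n (λ c → weight φ c * 𝟙 (falls 0 c)) ≡
  sumContents m n (λ c → weight φ c * 𝟙 (falls 0 (c ∷ʳ 0)))
sumContents-falls m n φ = begin
  sumContents (suc m) n (λ c → weight φ c * 𝟙 (falls 0 c))
    ≡⟨ sumContents-∷ʳ m n (λ c → weight φ c * 𝟙 (falls 0 c)) ⟩
  sumSplit n (λ k l → sumContents m l (λ c → weight φ (c ∷ʳ k) * 𝟙 (falls 0 (c ∷ʳ k))))
    ≡⟨ sumSplit-first n (λ k l → trans (sumContents-cong m l (λ c _ _ → vanish k c)) (sumContents-0 m l)) ⟩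
  sumContents m n (λ c → weight φ (c ∷ʳ 0) * 𝟙 (falls 0 (c ∷ʳ 0)))
    ≡⟨ sumContents-cong m n (λ c _ _ → cong (_* 𝟙 (falls 0 (c ∷ʳ 0))) (weight-∷ʳ φ c 0)) ⟩
  sumContents m n (λ c → weight φ c * 𝟙 (falls 0 (c ∷ʳ 0))) ∎
  where
  vanish : ∀ k c → weight φ (c ∷ʳ suc k) * 𝟙 (falls 0 (c ∷ʳ suc k)) ≡ 0
  vanish k c =
    trans (cong (weight φ (c ∷ʳ suc k) *_) (𝟙-false (falls-∷ʳ-suc 0 c k))) (*-zeroʳ (weight φ (c ∷ʳ suc k)))

-- Counting 321-avoiding words by content

sumWords : ℕ → ℕ → (List ℕ → ℕ) → ℕ
sumWords m zero    Φ = Φ []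
sumWords m (suc n) Φ = sumBelow m (λ a → sumWords m n (Φ ∘ (a ∷_)))

-- Sum over all shuffles of k zeros with the word v, whose letters are raised by 1.
sumShuffles : ℕ → List ℕ → (List ℕ → ℕ) → ℕ
sumShuffles zero    []      Φ = Φ []
sumShuffles zero    (a ∷ v) Φ = sumShuffles zero v (Φ ∘ (suc a ∷_))
sumShuffles (suc k) []      Φ = sumShuffles k [] (Φ ∘ (0 ∷_))
sumShuffles (suc k) (a ∷ v) Φ = sumShuffles k (a ∷ v) (Φ ∘ (0 ∷_)) + sumShuffles (suc k) v (Φ ∘ (suc a ∷_))

sumWords-cong : ∀ m n {Φ Ψ} → (∀ w → Φ w ≡ Ψ w) → sumWords m n Φ ≡ sumWords m n Ψ
sumWords-cong m zero    eq = eq []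
sumWords-cong m (suc n) eq = sumBelow-cong m (λ a _ → sumWords-cong m n (λ w → eq (a ∷ w)))

sumWords-+ : ∀ m n Φ Ψ → sumWords m n (λ w → Φ w + Ψ w) ≡ sumWords m n Φ + sumWords m n Ψ
sumWords-+ m zero    Φ Ψ = refl
sumWords-+ m (suc n) Φ Ψ =
  trans (sumBelow-cong m (λ a _ → sumWords-+ m n (Φ ∘ (a ∷_)) (Ψ ∘ (a ∷_)))) (sumBelow-+ m _ _)

-- Each word is a shuffle of its `k` zeros with its other letters, lowered to a word `v` over one
-- letter fewer. The induction on length sorts by the first entry.
sumWords-suc : ∀ m n Φ →
  sumWords (suc m) n Φ ≡ sumSplit n (λ k l → sumWords m l (λ v → sumShuffles k v Φ))
sumWords-suc m zero    Φ = refl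
sumWords-suc m (suc n) Φ = begin
  sumWords (suc m) n (Φ ∘ (0 ∷_)) + sumBelow m (λ a → sumWords (suc m) n (Φ ∘ (suc a ∷_)))
    ≡⟨ cong₂ _+_ (sumWords-suc m n (Φ ∘ (0 ∷_)))
                 (sumBelow-cong m (λ a _ → sumWords-suc m n (Φ ∘ (suc a ∷_)))) ⟩
  sumSplit n zeroFirst +
    sumBelow m (λ a → sumSplit n (λ k l → sumWords m l (λ v → sumShuffles k v (Φ ∘ (suc a ∷_)))))
    ≡⟨ cong (sumSplit n zeroFirst +_) (sumSplit-sumBelow n m (λ k l a → sumWords m l (λ v → sumShuffles k v (Φ ∘ (suc a ∷_))))) ⟨
  sumSplit n zeroFirst + sumSplit n letterFirst
    ≡⟨ sumSplit-suc n {λ k l → sumWords m l (λ v → sumShuffles k v Φ)} zeroFirst letterFirst (λ _ → refl) (λ _ → refl)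
         (λ k l → sumWords-+ m (suc l) (λ v → sumShuffles k v (Φ ∘ (0 ∷_))) (shuffleTail (suc k))) ⟨
  sumSplit (suc n) (λ k l → sumWords m l (λ v → sumShuffles k v Φ)) ∎
  where
  zeroFirst letterFirst : ℕ → ℕ → ℕ
  zeroFirst   k l = sumWords m l (λ v → sumShuffles k v (Φ ∘ (0 ∷_)))
  letterFirst k l = sumBelow m (λ a → sumWords m l (λ v → sumShuffles k v (Φ ∘ (suc a ∷_))))
  shuffleTail : ℕ → List ℕ → ℕ
  -- The letter-first summand of `sumShuffles`, extended by 0 to the empty word so that `sumWords-+`
  -- applies.
  shuffleTail k []      = 0
  shuffleTail k (a ∷ v) = sumShuffles k v (Φ ∘ (suc a ∷_))

zeros : List ℕ → ℕ
zeros []          = 0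
zeros (zero ∷ w)  = suc (zeros w)
zeros (suc _ ∷ w) = zeros w

lower : List ℕ → List ℕ
lower []          = []
lower (zero ∷ w)  = lower w
lower (suc a ∷ w) = a ∷ lower w

content : ℕ → List ℕ → List ℕ
content zero    w = []
content (suc m) w = zeros w ∷ content m (lower w)

-- Every shuffle `w` in the sum has `zeros w = k` and `lower w = v`, so the second factor is
-- constant.
sumShuffles-content : ∀ k v (Φ : List ℕ → ℕ) (F : ℕ → List ℕ → ℕ) →
  sumShuffles k v (λ w → Φ w * F (zeros w) (lower w)) ≡ sumShuffles k v Φ * F k v
sumShuffles-content zero    []      Φ F = refl
sumShuffles-content zero    (a ∷ v) Φ F =
  sumShuffles-content zero v (Φ ∘ (suc a ∷_)) (λ k → F k ∘ (a ∷_))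
sumShuffles-content (suc k) []      Φ F = sumShuffles-content k [] (Φ ∘ (0 ∷_)) (F ∘ suc)
sumShuffles-content (suc k) (a ∷ v) Φ F = trans
  (cong₂ _+_ (sumShuffles-content k (a ∷ v) (Φ ∘ (0 ∷_)) (F ∘ suc))
             (sumShuffles-content (suc k) v (Φ ∘ (suc a ∷_)) (λ k → F k ∘ (a ∷_))))
  (sym (*-distribʳ-+ (F (suc k) (a ∷ v)) (sumShuffles k (a ∷ v) (Φ ∘ (0 ∷_))) _))

-- Reads a word from left to right: t is the largest letter read so far, and d
-- the largest one that has a larger letter before it (0 if there is none).
avoids : ℕ → ℕ → List ℕ → Bool
avoids d t []      = true
avoids d t (a ∷ w) =
  if a <ᵇ d then false else if a <ᵇ t then avoids a t w else avoids d a w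

-- The length of the longest prefix that continues a weakly increasing run ending in `x`; for
-- `x = 0`, of the longest weakly increasing prefix.
ascent : ℕ → List ℕ → ℕ
ascent x []      = 0
ascent x (a ∷ w) = if a <ᵇ x then 0 else suc (ascent a w)

sumShuffles-const-0 : ∀ k v → sumShuffles k v (λ _ → 0) ≡ 0
sumShuffles-const-0 zero    []      = refl
sumShuffles-const-0 zero    (a ∷ v) = sumShuffles-const-0 zero v
sumShuffles-const-0 (suc k) []      = sumShuffles-const-0 k []
sumShuffles-const-0 (suc k) (a ∷ v) =
  cong₂ _+_ (sumShuffles-const-0 k (a ∷ v)) (sumShuffles-const-0 (suc k) v)

sumShuffles-zero : ∀ v Φ → sumShuffles 0 v Φ ≡ Φ (map suc v)
sumShuffles-zero []      Φ = refl
sumShuffles-zero (a ∷ v) Φ = sumShuffles-zero v (Φ ∘ (suc a ∷_))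

avoids-map-suc : ∀ d t v → avoids (suc d) (suc t) (map suc v) ≡ avoids d t v
avoids-map-suc d t []      = refl
avoids-map-suc d t (a ∷ v) with a <ᵇ d | a <ᵇ t
... | true  | _     = refl
... | false | true  = avoids-map-suc a t v
... | false | false = avoids-map-suc d a v

avoids-0-map-suc : ∀ t v → avoids 0 (suc t) (map suc v) ≡ avoids 0 t v
avoids-0-map-suc t []      = refl
avoids-0-map-suc t (a ∷ v) with a <ᵇ t
... | true  = avoids-map-suc a t v
... | false = avoids-0-map-suc a v

ascent-map-suc : ∀ x v → ascent (suc x) (map suc v) ≡ ascent x v
ascent-map-suc x []      = refl
ascent-map-suc x (a ∷ v) with a <ᵇ x
... | true  = refl
... | false = cong suc (ascent-map-suc a v)

-- A zero is still to come, and it completes a 321 with `suc d` and the larger letter before that.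
sumShuffles-blocked : ∀ k v d t (Φ : List ℕ → ℕ) →
  sumShuffles (suc k) v (λ w → 𝟙 (avoids (suc d) t w) * Φ w) ≡ 0
sumShuffles-blocked k []      d t Φ = sumShuffles-const-0 k []
sumShuffles-blocked k (a ∷ v) d t Φ
  rewrite sumShuffles-const-0 k (a ∷ v) with a <ᵇ d | suc a <ᵇ t
... | true  | _     = sumShuffles-const-0 (suc k) v
... | false | true  = sumShuffles-blocked k v a t (Φ ∘ (suc a ∷_))
... | false | false = sumShuffles-blocked k v d (suc a) (Φ ∘ (suc a ∷_))

-- Reading a zero keeps the state `0`, `suc x`, so zeros may fill any of the `ascent x v + 1` gaps
-- up to the first descent of `v` read after `x`; behind that descent they are blocked.
sumShuffles-count : ∀ k v x b →
  sumShuffles k v (λ w → 𝟙 (avoids 0 (suc x) w) * b) ≡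
  𝟙 (avoids 0 x v) * (b * multichoose k (ascent x v))
sumShuffles-count zero v x b = begin
  sumShuffles 0 v (λ w → 𝟙 (avoids 0 (suc x) w) * b)  ≡⟨ sumShuffles-zero v _ ⟩
  𝟙 (avoids 0 (suc x) (map suc v)) * b                ≡⟨ cong₂ _*_ (cong 𝟙 (avoids-0-map-suc x v)) (sym (*-identityʳ b)) ⟩
  𝟙 (avoids 0 x v) * (b * 1)                          ∎
sumShuffles-count (suc k) [] x b =
  trans (sumShuffles-count k [] x b) (cong (λ a → 1 * (b * a)) (multichoose-0 k))
sumShuffles-count (suc k) (a ∷ v) x b with a <ᵇ x | sumShuffles-count k (a ∷ v) x b
... | true  | count = trans (cong₂ _+_ count (sumShuffles-blocked k v a (suc x) (λ _ → b)))
  (trans (+-identityʳ _) (cong (λ c → 𝟙 (avoids a x v) * (b * c)) (multichoose-0 k)))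
... | false | count = begin
  _ ≡⟨ cong₂ _+_ count (sumShuffles-count (suc k) v a b) ⟩
  𝟙 (avoids 0 a v) * (b * multichoose k (suc q)) + 𝟙 (avoids 0 a v) * (b * multichoose (suc k) q)
    ≡⟨ lem (𝟙 (avoids 0 a v)) b _ _ ⟩
  𝟙 (avoids 0 a v) * (b * (multichoose k (suc q) + multichoose (suc k) q)) ∎
  where
  q : ℕ
  q = ascent a v
  lem : ∀ a b c d → a * (b * c) + a * (b * d) ≡ a * (b * (c + d))
  lem = solve-∀

-- The run after `suc x` stops at the first zero. With the position of that zero fixed, the value of
-- `φ` is a constant `b`, and `sumShuffles-count` places the other `k` zeros.
sumShuffles-tail : ∀ k v x (φ : ℕ → ℕ) →
  sumShuffles (suc k) v (λ w → 𝟙 (avoids 0 (suc x) w) * φ (ascent (suc x) w)) ≡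
  𝟙 (avoids 0 x v) * (φ 0 * multichoose k (ascent x v) + afterLetter k φ (ascent x v))
sumShuffles-tail k [] x φ =
  trans (sumShuffles-count k [] x (φ 0)) (cong (1 *_) (sym (+-identityʳ _)))
sumShuffles-tail k (a ∷ v) x φ with a <ᵇ x | sumShuffles-count k (a ∷ v) x (φ 0)
... | true  | count =
  trans (cong₂ _+_ count (sumShuffles-blocked k v a (suc x) (λ _ → φ 0)))
 (trans (+-identityʳ _) (cong (𝟙 (avoids a x v) *_) (sym (+-identityʳ _))))
... | false | count =
  trans (cong₂ _+_ count (sumShuffles-tail k v a (φ ∘ suc)))
        (sym (*-distribˡ-+ (𝟙 (avoids 0 a v)) (φ 0 * multichoose k (suc (ascent a v))) _))

-- A leading zero lengthens the prefix by one and leaves a shuffle of one zero fewer; with a leading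
-- letter of `v`, `sumShuffles-tail` applies. These are the two summands of `insert`.
sumShuffles-insert : ∀ k v (φ : ℕ → ℕ) →
  sumShuffles k v (λ w → 𝟙 (avoids 0 0 w) * φ (ascent 0 w)) ≡ 𝟙 (avoids 0 0 v) * insert k φ (ascent 0 v)
sumShuffles-insert zero    []      φ = refl
sumShuffles-insert zero    (a ∷ v) φ =
  trans (sumShuffles-zero v _)
        (cong₂ (λ x y → 𝟙 x * φ (suc y)) (avoids-0-map-suc a v) (ascent-map-suc a v))
sumShuffles-insert (suc k) []      φ =
  trans (sumShuffles-insert k [] (φ ∘ suc)) (cong (1 *_) (sym (+-identityʳ _)))
sumShuffles-insert (suc k) (a ∷ v) φ =
  trans (cong₂ _+_ (sumShuffles-insert k (a ∷ v) (φ ∘ suc)) (sumShuffles-tail k v a (φ ∘ suc)))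
        (sym (*-distribˡ-+ (𝟙 (avoids 0 a v)) (insert k (φ ∘ suc) (suc (ascent a v))) _))

-- Induction on the alphabet: removing the letter 0 turns `φ` into `insert k φ` and fixes the first
-- argument entry of `f` as `k`. The factor `f` lets one lemma serve both counts.
sumWords-weight : ∀ m n (φ : ℕ → ℕ) (f : List ℕ → ℕ) →
  sumWords m n (λ w → 𝟙 (avoids 0 0 w) * φ (ascent 0 w) * f (content m w)) ≡
  sumContents m n (λ c → weight φ c * f c)
sumWords-weight zero    zero    φ f = cong (_* f []) (*-identityˡ (φ 0))
sumWords-weight zero    (suc n) φ f = refl
sumWords-weight (suc m) n       φ f = begin
  sumWords (suc m) n (λ w → Φ w * f (content (suc m) w))
    ≡⟨ sumWords-suc m n (λ w → Φ w * f (content (suc m) w)) ⟩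
  sumSplit n (λ k l → sumWords m l (λ v → sumShuffles k v (λ w → Φ w * f (content (suc m) w))))
    ≡⟨ sumSplit-cong n (λ k l _ → trans (sumWords-cong m l (insertion k))
                                        (sumWords-weight m l (insert k φ) (f ∘ (k ∷_)))) ⟩
  sumContents (suc m) n (λ c → weight φ c * f c) ∎
  where
  Φ : List ℕ → ℕ
  Φ w = 𝟙 (avoids 0 0 w) * φ (ascent 0 w)
  insertion : ∀ k v → sumShuffles k v (λ w → Φ w * f (content (suc m) w)) ≡
    𝟙 (avoids 0 0 v) * insert k φ (ascent 0 v) * f (k ∷ content m v)
  insertion k v =
    trans (sumShuffles-content k v Φ (λ j u → f (j ∷ content m u)))
          (cong (_* f (k ∷ content m v)) (sumShuffles-insert k v φ))

-- From enumerated words to sums over their codes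

codes : ∀ {m n} → Word m n → List ℕ
codes w = map toℕ (toList w)

length-filter : ∀ {A : Set} {P : A → Set} (P? : Decidable P) xs →
  length (filter P? xs) ≡ sum (map (λ x → 𝟙 (does (P? x))) xs)
length-filter P? []       = refl
length-filter P? (x ∷ xs) with does (P? x)
... | true  = cong suc (length-filter P? xs)
... | false = length-filter P? xs

sum-cartesianProductWith : ∀ {A B C : Set} (f : A → B → C) (Φ : C → ℕ) xs ys →
  sum (map Φ (cartesianProductWith f xs ys)) ≡ sum (map (λ x → sum (map (Φ ∘ f x) ys)) xs)
sum-cartesianProductWith f Φ []       ys = refl
sum-cartesianProductWith f Φ (x ∷ xs) ys = begin
  sum (map Φ (map (f x) ys ++ rest))             ≡⟨ cong sum (map-++ Φ (map (f x) ys) rest) ⟩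
  sum (map Φ (map (f x) ys) ++ map Φ rest)       ≡⟨ sum-++ (map Φ (map (f x) ys)) _ ⟩
  sum (map Φ (map (f x) ys)) + sum (map Φ rest)  ≡⟨ cong₂ _+_ (cong sum (sym (map-∘ ys))) (sum-cartesianProductWith f Φ xs ys) ⟩
  _                                              ∎
  where rest = cartesianProductWith f xs ys

sum-tabulate : ∀ {A : Set} m (g : Fin m → A) (Φ : A → ℕ) Ψ → (∀ i → Φ (g i) ≡ Ψ (toℕ i)) →
  sum (map Φ (tabulate g)) ≡ sumBelow m Ψ
sum-tabulate zero    g Φ Ψ eq = refl
sum-tabulate (suc m) g Φ Ψ eq =
  cong₂ _+_ (eq Fin.zero) (sum-tabulate m (g ∘ Fin.suc) Φ (Ψ ∘ suc) (eq ∘ Fin.suc))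

sum-words : ∀ m n (Φ : Word m n → ℕ) Ψ → (∀ w → Φ w ≡ Ψ (codes w)) →
  sum (map Φ (words m n)) ≡ sumWords m n Ψ
sum-words m zero    Φ Ψ eq = trans (+-identityʳ _) (eq [])
sum-words m (suc n) Φ Ψ eq =
  trans (sum-cartesianProductWith _∷_ Φ (allFin m) (words m n))
          (sum-tabulate m id _ _ λ a → sum-words m n (Φ ∘ (a ∷_)) (Ψ ∘ (toℕ a ∷_)) (eq ∘ (a ∷_)))

-- The Boolean test for 321 agrees with Avoids321

Below : ℕ → List ℕ → Set
Below d w = Any (_< d) w

data DescentBelow (t : ℕ) : List ℕ → Set where
  here  : ∀ {a w} → a < t → Below a w → DescentBelow t (a ∷ w)
  there : ∀ {a w} → DescentBelow t w → DescentBelow t (a ∷ w)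

data Pattern321 : List ℕ → Set where
  here  : ∀ {a w} → DescentBelow a w → Pattern321 (a ∷ w)
  there : ∀ {a w} → Pattern321 w → Pattern321 (a ∷ w)

Below-mono : ∀ {d e w} → d ≤ e → Below d w → Below e w
Below-mono d≤e = Any.map (λ a<d → <-≤-trans a<d d≤e)

DescentBelow-mono : ∀ {t u w} → t ≤ u → DescentBelow t w → DescentBelow u w
DescentBelow-mono t≤u (here a<t b) = here (<-≤-trans a<t t≤u) b
DescentBelow-mono t≤u (there p)    = there (DescentBelow-mono t≤u p)

-- The unread word `w` completes a 321 of which two, one or no letters have already been read.
Bad : ℕ → ℕ → List ℕ → Set
Bad d t w = Below d w ⊎ DescentBelow t w ⊎ Pattern321 w

avoids-sound : ∀ d t w → T (avoids d t w) → ¬ Bad d t w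
avoids-sound d t [] _ (inj₂ (inj₁ ()))
avoids-sound d t [] _ (inj₂ (inj₂ ()))
avoids-sound d t (a ∷ w) p bad with a <ᵇ d | <ᵇ-reflects-< a d | a <ᵇ t | <ᵇ-reflects-< a t
... | false | ofⁿ a≮d | true  | ofʸ a<t = avoids-sound a t w p (reduce bad)
  where
  reduce : Bad d t (a ∷ w) → Bad a t w
  reduce (inj₁ (here a<d))           = contradiction a<d a≮d
  reduce (inj₁ (there b))            = inj₁ (Below-mono (≮⇒≥ a≮d) b)
  reduce (inj₂ (inj₁ (here _ b)))    = inj₁ b
  reduce (inj₂ (inj₁ (there q)))     = inj₂ (inj₁ q)
  -- A 321 with top `a` remains one with the larger, earlier letter `t` as top.
  reduce (inj₂ (inj₂ (here q)))      = inj₂ (inj₁ (DescentBelow-mono (<⇒≤ a<t) q))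
  reduce (inj₂ (inj₂ (there q)))     = inj₂ (inj₂ q)
... | false | ofⁿ a≮d | false | ofⁿ a≮t = avoids-sound d a w p (reduce bad)
  where
  reduce : Bad d t (a ∷ w) → Bad d a w
  reduce (inj₁ (here a<d))           = contradiction a<d a≮d
  reduce (inj₁ (there b))            = inj₁ b
  reduce (inj₂ (inj₁ (here a<t _)))  = contradiction a<t a≮t
  reduce (inj₂ (inj₁ (there q)))     = inj₂ (inj₁ (DescentBelow-mono (≮⇒≥ a≮t) q))
  reduce (inj₂ (inj₂ (here q)))      = inj₂ (inj₁ q)
  reduce (inj₂ (inj₂ (there q)))     = inj₂ (inj₂ q)

avoids-complete : ∀ d t w → ¬ Bad d t w → T (avoids d t w)
avoids-complete d t []      ok = tt
avoids-complete d t (a ∷ w) ok with a <ᵇ d | <ᵇ-reflects-< a d | a <ᵇ t | <ᵇ-reflects-< a t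
... | true  | ofʸ a<d | _     | _       = ok (inj₁ (here a<d))
... | false | _       | true  | ofʸ a<t = avoids-complete a t w λ where
  (inj₁ b)        → ok (inj₂ (inj₁ (here a<t b)))
  (inj₂ (inj₁ q)) → ok (inj₂ (inj₁ (there q)))
  (inj₂ (inj₂ q)) → ok (inj₂ (inj₂ (there q)))
... | false | _       | false | _       = avoids-complete d a w λ where
  (inj₁ b)        → ok (inj₁ (there b))
  (inj₂ (inj₁ q)) → ok (inj₂ (inj₂ (here q)))
  (inj₂ (inj₂ q)) → ok (inj₂ (inj₂ (there q)))

Below⁺ : ∀ {m n d} (w : Word m n) i → toℕ (Vec.lookup w i) < d → Below d (codes w)
Below⁺ (a ∷ w) Fin.zero    a<d = here a<d
Below⁺ (a ∷ w) (Fin.suc i) p   = there (Below⁺ w i p)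

Below⁻ : ∀ {m n d} (w : Word m n) → Below d (codes w) → ∃[ i ] toℕ (Vec.lookup w i) < d
Below⁻ (a ∷ w) (here a<d) = Fin.zero , a<d
Below⁻ (a ∷ w) (there b)  with i , p ← Below⁻ w b = Fin.suc i , p

DescentBelow⁺ : ∀ {m n t} (w : Word m n) i j → i Fin.< j →
  toℕ (Vec.lookup w i) < t → Vec.lookup w j Fin.< Vec.lookup w i → DescentBelow t (codes w)
DescentBelow⁺ (a ∷ w) Fin.zero    (Fin.suc j) _         a<t b = here a<t (Below⁺ w j b)
DescentBelow⁺ (a ∷ w) (Fin.suc i) (Fin.suc j) (s<s i<j) p   q = there (DescentBelow⁺ w i j i<j p q)

DescentBelow⁻ : ∀ {m n t} (w : Word m n) → DescentBelow t (codes w) →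
  ∃[ i ] ∃[ j ] (i Fin.< j × toℕ (Vec.lookup w i) < t × Vec.lookup w j Fin.< Vec.lookup w i)
DescentBelow⁻ (a ∷ w) (here a<t b) with j , p ← Below⁻ w b = Fin.zero , Fin.suc j , z<s , a<t , p
DescentBelow⁻ (a ∷ w) (there q) with i , j , i<j , p , r ← DescentBelow⁻ w q =
  Fin.suc i , Fin.suc j , s<s i<j , p , r

Pattern321⁺ : ∀ {m n} (w : Word m n) → Contains321 w → Pattern321 (codes w)
Pattern321⁺ (a ∷ w) (Fin.zero , Fin.suc j , Fin.suc k , _ , s<s j<k , p , q) =
  here (DescentBelow⁺ w j k j<k p q)
Pattern321⁺ (a ∷ w) (Fin.suc i , Fin.suc j , Fin.suc k , s<s i<j , s<s j<k , p , q) =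
  there (Pattern321⁺ w (i , j , k , i<j , j<k , p , q))

Pattern321⁻ : ∀ {m n} (w : Word m n) → Pattern321 (codes w) → Contains321 w
Pattern321⁻ (a ∷ w) (here d) with j , k , j<k , p , q ← DescentBelow⁻ w d =
  Fin.zero , Fin.suc j , Fin.suc k , z<s , s<s j<k , p , q
Pattern321⁻ (a ∷ w) (there d) with i , j , k , i<j , j<k , p , q ← Pattern321⁻ w d =
  Fin.suc i , Fin.suc j , Fin.suc k , s<s i<j , s<s j<k , p , q

no-Below-0 : ∀ {w} → ¬ Below 0 w
no-Below-0 (there b) = no-Below-0 b

no-DescentBelow-0 : ∀ {w} → ¬ DescentBelow 0 w
no-DescentBelow-0 (there q) = no-DescentBelow-0 q

Avoids321⇔avoids : ∀ {m n} (w : Word m n) → Avoids321 w ⇔ T (avoids 0 0 (codes w))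
Avoids321⇔avoids w = mk⇔
  (λ av → avoids-complete 0 0 (codes w) λ where
    (inj₁ b)        → no-Below-0 b
    (inj₂ (inj₁ q)) → no-DescentBelow-0 q
    (inj₂ (inj₂ q)) → av (Pattern321⁻ w q))
  (λ p c → avoids-sound 0 0 (codes w) p (inj₂ (inj₂ (Pattern321⁺ w c))))

-- Parking functions in terms of content

-- The parking inequality for codes and positions counted from 0; the offset `h` makes room for the
-- letters already removed.
Dominated : ℕ → List ℕ → Set
Dominated h []      = ⊤
Dominated h (a ∷ l) = a ≤ h × Dominated (suc h) l

zeros-↭ : ∀ {l l′} → l ↭ l′ → zeros l ≡ zeros l′
zeros-↭ ↭.refl                   = refl
zeros-↭ (prep zero p)            = cong suc (zeros-↭ p)
zeros-↭ (prep (suc _) p)         = zeros-↭ p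
zeros-↭ (swap zero zero p)       = cong (suc ∘ suc) (zeros-↭ p)
zeros-↭ (swap zero (suc _) p)    = cong suc (zeros-↭ p)
zeros-↭ (swap (suc _) zero p)    = cong suc (zeros-↭ p)
zeros-↭ (swap (suc _) (suc _) p) = zeros-↭ p
zeros-↭ (↭.trans p q)            = trans (zeros-↭ p) (zeros-↭ q)

lower-↭ : ∀ {l l′} → l ↭ l′ → lower l ↭ lower l′
lower-↭ ↭.refl                   = ↭.refl
lower-↭ (prep zero p)            = lower-↭ p
lower-↭ (prep (suc a) p)         = prep a (lower-↭ p)
lower-↭ (swap zero zero p)       = lower-↭ p
lower-↭ (swap zero (suc b) p)    = prep b (lower-↭ p)
lower-↭ (swap (suc a) zero p)    = prep a (lower-↭ p)
lower-↭ (swap (suc a) (suc b) p) = swap a b (lower-↭ p)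
lower-↭ (↭.trans p q)            = ↭.trans (lower-↭ p) (lower-↭ q)

content-↭ : ∀ m {l l′} → l ↭ l′ → content m l ≡ content m l′
content-↭ zero    p = refl
content-↭ (suc m) p = cong₂ _∷_ (zeros-↭ p) (content-↭ m (lower-↭ p))

zeros+lower : ∀ l → zeros l + length (lower l) ≡ length l
zeros+lower []          = refl
zeros+lower (zero ∷ l)  = cong suc (zeros+lower l)
zeros+lower (suc a ∷ l) = trans (+-suc (zeros l) _) (cong suc (zeros+lower l))

zeros-positive : ∀ {a l} → All (suc a ≤_) l → zeros l ≡ 0
zeros-positive []            = refl
zeros-positive (s≤s _ ∷ all) = zeros-positive all

lower-All : ∀ {a l} → All (suc a ≤_) l → All (a ≤_) (lower l)
lower-All []              = []
lower-All (s≤s a≤b ∷ all) = a≤b ∷ lower-All all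

lower-sorted : ∀ {l} → AllPairs _≤_ l → AllPairs _≤_ (lower l)
lower-sorted []                 = []
lower-sorted {zero ∷ l}  (_ ∷ s)   = lower-sorted s
lower-sorted {suc a ∷ l} (all ∷ s) = lower-All all ∷ lower-sorted s

-- The zeros come first and each raises the bound by one, up to `suc h′`; lowering the remaining
-- letters lowers the bound to `h′`.
Dominated-lower : ∀ {h h′ l} → AllPairs _≤_ l → h + zeros l ≡ suc h′ →
  Dominated h l ⇔ Dominated h′ (lower l)
Dominated-lower [] eq = mk⇔ _ _
Dominated-lower {h} {l = zero ∷ l} (_ ∷ s) eq = mk⇔
  (λ (_ , p) → Equivalence.to rec p) (λ p → z≤n , Equivalence.from rec p)
  where rec = Dominated-lower s (trans (sym (+-suc h (zeros l))) eq)
Dominated-lower {h} {h′} {suc a ∷ l} (all ∷ s) eq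
  with refl ← trans (sym (+-identityʳ h)) (trans (cong (h +_) (sym (zeros-positive all))) eq) = mk⇔
  (λ { (s≤s a≤h′ , p) → a≤h′ , Equivalence.to rec p }) (λ (a≤h′ , p) → s≤s a≤h′ , Equivalence.from rec p)
  where rec = Dominated-lower s (cong suc eq)

-- Removing the smallest letter changes `h` exactly as a step of the walk does and preserves the
-- equation for `m`. At `m = 0` it forces `h = 0` and an empty list, and the appended 0 is the final
-- fall.
Dominated⇔falls : ∀ m {h l} → AllPairs _≤_ l → h + length l ≡ m →
  Dominated h l ⇔ T (falls h (content m l ∷ʳ 0))
Dominated⇔falls zero {zero} {[]} s eq = mk⇔ _ _
Dominated⇔falls (suc m) {h} {l} s eq with h + zeros l in eq₁
... | suc h′ = mk⇔ (Equivalence.to rec ∘ Equivalence.to lowering) (Equivalence.from lowering ∘ Equivalence.from rec)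
  where
  lowering = Dominated-lower s eq₁
  rec = Dominated⇔falls m (lower-sorted s) (suc-injective (begin
    suc h′ + length (lower l)           ≡⟨ cong (_+ length (lower l)) eq₁ ⟨
    h + zeros l + length (lower l)      ≡⟨ +-assoc h (zeros l) _ ⟩
    h + (zeros l + length (lower l))    ≡⟨ cong (h +_) (zeros+lower l) ⟩
    h + length l                        ≡⟨ eq ⟩
    suc m                               ∎))
-- Here `h = 0` and the smallest letter is positive: the first inequality fails, and the walk falls
-- before its end.
... | zero with h | l
...   | zero | suc a ∷ l′ = mk⇔ (λ ()) (λ p → contradiction p (no-early-fall (content m (a ∷ lower l′))))
  where
  no-early-fall : ∀ c → ¬ T (fallsAfter 0 (c ∷ʳ 0))
  no-early-fall []      ()
  no-early-fall (_ ∷ _) ()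

Dominated⇔lookup : ∀ {m} h (l : List (Fin m)) →
  (∀ i → toℕ (List.lookup l i) ≤ h + toℕ i) ⇔ Dominated h (map toℕ l)
Dominated⇔lookup h []      = mk⇔ _ (λ _ ())
Dominated⇔lookup h (a ∷ l) = mk⇔
  (λ p → subst (toℕ a ≤_) (+-identityʳ h) (p Fin.zero) ,
         Equivalence.to rec (λ i → subst (toℕ (List.lookup l i) ≤_) (+-suc h (toℕ i)) (p (Fin.suc i))))
  (λ { (a≤h , p) Fin.zero    → subst (toℕ a ≤_) (sym (+-identityʳ h)) a≤h
     ; (a≤h , p) (Fin.suc i) → subst (toℕ (List.lookup l i) ≤_) (sym (+-suc h (toℕ i))) (Equivalence.from rec p i) })
  where rec = Dominated⇔lookup (suc h) l

-- Content is invariant under permutation, so it may be read off the sorted rearrangement.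
ParkingFunction⇔falls : ∀ {n} (p : Word n n) →
  ParkingFunction p ⇔ T (falls 0 (content n (codes p) ∷ʳ 0))
ParkingFunction⇔falls {n} p = mk⇔
  (λ pf → subst (λ c → T (falls 0 (c ∷ʳ 0))) same
            (Equivalence.to walk (Equivalence.to dominated (≤-pred ∘ pf))))
  (λ f i → s≤s (Equivalence.from dominated (Equivalence.from walk
            (subst (λ c → T (falls 0 (c ∷ʳ 0))) (sym same) f)) i))
  where
  open Data.List.Sort (Fin.≤-decTotalOrder n)
  perm : map toℕ (sort (toList p)) ↭ codes p
  perm = map⁺ toℕ (sort-↭ (toList p))
  same : content n (map toℕ (sort (toList p))) ≡ content n (codes p)
  same = content-↭ n perm
  dominated = Dominated⇔lookup 0 (sort (toList p))
  walk = Dominated⇔falls n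
    (AllPairs.map⁺ (Linked⇒AllPairs ≤-trans (sort-↗ (toList p))))
    (trans (↭-length perm) (trans (length-map toℕ (toList p)) (length-toList p)))

-- Both counts as sums over contents, and their ratio

w321-weight : ∀ n m → w321 n m ≡ sumContents m n (weight (λ _ → 1))
w321-weight n m = begin
  w321 n m
    ≡⟨ length-filter avoids321? (words m n) ⟩
  sum (map (λ w → 𝟙 (does (avoids321? w))) (words m n))
    ≡⟨ sum-words m n _ (λ w → 𝟙 (avoids 0 0 w) * 1 * 1) indicator ⟩
  sumWords m n (λ w → 𝟙 (avoids 0 0 w) * 1 * 1)
    ≡⟨ sumWords-weight m n (λ _ → 1) (λ _ → 1) ⟩
  sumContents m n (λ c → weight (λ _ → 1) c * 1)
    ≡⟨ sumContents-cong m n (λ c _ _ → *-identityʳ (weight (λ _ → 1) c)) ⟩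
  sumContents m n (weight (λ _ → 1)) ∎
  where
  indicator : ∀ (w : Word m n) → 𝟙 (does (avoids321? w)) ≡ 𝟙 (avoids 0 0 (codes w)) * 1 * 1
  indicator w = trans (cong 𝟙 (does-⇔ (Avoids321⇔avoids w) (avoids321? w) (T? (avoids 0 0 (codes w)))))
                        (sym (trans (*-identityʳ _) (*-identityʳ _)))

∣PF321∣-weight : ∀ n →
  ∣PF321∣ n ≡ sumContents n n (λ c → weight (λ _ → 1) c * 𝟙 (falls 0 (c ∷ʳ 0)))
∣PF321∣-weight n = begin
  ∣PF321∣ n
    ≡⟨ length-filter (λ p → parkingFunction? p ×-dec avoids321? p) (words n n) ⟩
  sum (map (λ p → 𝟙 (does (parkingFunction? p) ∧ does (avoids321? p))) (words n n))
    ≡⟨ sum-words n n _ (λ w → 𝟙 (avoids 0 0 w) * 1 * 𝟙 (falls 0 (content n w ∷ʳ 0))) indicator ⟩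
  sumWords n n (λ w → 𝟙 (avoids 0 0 w) * 1 * 𝟙 (falls 0 (content n w ∷ʳ 0)))
    ≡⟨ sumWords-weight n n (λ _ → 1) (λ c → 𝟙 (falls 0 (c ∷ʳ 0))) ⟩
  sumContents n n (λ c → weight (λ _ → 1) c * 𝟙 (falls 0 (c ∷ʳ 0))) ∎
  where
  𝟙-∧ : ∀ a b → 𝟙 (a ∧ b) ≡ 𝟙 b * 1 * 𝟙 a
  𝟙-∧ false false = refl
  𝟙-∧ false true  = refl
  𝟙-∧ true  false = refl
  𝟙-∧ true  true  = refl
  indicator : ∀ (p : Word n n) → 𝟙 (does (parkingFunction? p) ∧ does (avoids321? p)) ≡
    𝟙 (avoids 0 0 (codes p)) * 1 * 𝟙 (falls 0 (content n (codes p) ∷ʳ 0))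
  indicator p = trans
    (cong₂ (λ a b → 𝟙 (a ∧ b))
      (does-⇔ (ParkingFunction⇔falls p) (parkingFunction? p) (T? (falls 0 (content n (codes p) ∷ʳ 0))))
      (does-⇔ (Avoids321⇔avoids p) (avoids321? p) (T? (avoids 0 0 (codes p)))))
    (𝟙-∧ (falls 0 (content n (codes p) ∷ʳ 0)) (avoids 0 0 (codes p)))

suc*∣PF321∣ : ∀ n → suc n * ∣PF321∣ n ≡ w321 n (suc n)
suc*∣PF321∣ n = begin
  suc n * ∣PF321∣ n
    ≡⟨ cong (suc n *_) (∣PF321∣-weight n) ⟩
  suc n * sumContents n n (λ c → weight (λ _ → 1) c * 𝟙 (falls 0 (c ∷ʳ 0)))
    ≡⟨ cong (suc n *_) (sumContents-falls n n (λ _ → 1)) ⟨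
  suc n * sumContents (suc n) n (λ c → weight (λ _ → 1) c * 𝟙 (falls 0 c))
    ≡⟨ sumContents-weight n (λ _ → 1) ⟩
  sumContents (suc n) n (weight (λ _ → 1))
    ≡⟨ w321-weight n (suc n) ⟨
  w321 n (suc n) ∎

-- In unnormalised rationals equality is cross multiplication, so no gcd has to be computed. `mkℚᵘ`
-- stores the denominator minus one.
/1≡1/suc* : ∀ n a b → suc n * a ≡ b → (ℤ.+ a) / 1 ≡ ((ℤ.+ 1) / suc n) ℚ.* ((ℤ.+ b) / 1)
/1≡1/suc* n a b eq = toℚᵘ-injective
  (ℚᵘ.≃-trans (toℚᵘ-fromℚᵘ (mkℚᵘ (ℤ.+ a) 0)) (ℚᵘ.≃-trans (*≡* cross) (ℚᵘ.≃-sym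
    (ℚᵘ.≃-trans (toℚᵘ-homo-* ((ℤ.+ 1) / suc n) ((ℤ.+ b) / 1))
                (ℚᵘ.*-cong (toℚᵘ-fromℚᵘ (mkℚᵘ (ℤ.+ 1) n)) (toℚᵘ-fromℚᵘ (mkℚᵘ (ℤ.+ b) 0)))))))
  where
  cross : (ℤ.+ a) ℤ.* (ℤ.+ (suc n * 1)) ≡ (ℤ.+ 1) ℤ.* (ℤ.+ b) ℤ.* (ℤ.+ 1)
  cross = begin
    (ℤ.+ a) ℤ.* (ℤ.+ (suc n * 1)) ≡⟨ ℤ.pos-* a (suc n * 1) ⟨
    ℤ.+ (a * (suc n * 1))         ≡⟨ cong (λ c → ℤ.+ (a * c)) (*-identityʳ (suc n)) ⟩
    ℤ.+ (a * suc n)               ≡⟨ cong ℤ.+_ (*-comm a (suc n)) ⟩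
    ℤ.+ (suc n * a)               ≡⟨ cong ℤ.+_ eq ⟩
    ℤ.+ b                         ≡⟨ ℤ.*-identityˡ (ℤ.+ b) ⟨
    (ℤ.+ 1) ℤ.* (ℤ.+ b)           ≡⟨ ℤ.*-identityʳ _ ⟨
    (ℤ.+ 1) ℤ.* (ℤ.+ b) ℤ.* (ℤ.+ 1) ∎

theorem3p3 : ∀ (n : ℕ) .{{_ : NonZero n}} →
    (ℤ.+ ∣PF321∣ n) / 1 ≡ ((ℤ.+ 1) / suc n) ℚ.* ((ℤ.+ w321 n (suc n)) / 1)
theorem3p3 n = /1≡1/suc* n (∣PF321∣ n) (w321 n (suc n)) (suc*∣PF321∣ n)
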